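{- Let $n \geq 2$ be an integer. Then $R_n^* = S_n T_n$. In particular $$\det R_n^* = M^*(n) = \sum_{k=1}^n \mu^*(k).$$
   Context: For positive integers $i,j$, $i \parallel j$ means $i \mid j$ and $\gcd(i,j/i)=1$. The unitary Möbius function is $\mu^*(m)=(-1)^{\omega(m)}$, with $\omega(m)$ the number of distinct prime factors of $m$. For real $x>0$ and a positive integer $m$, $M^*(x,m) := \sum_{k \leq x,\ \gcd(k,m)=1}\mu^*(k)$ (sum over positive integers $k$), and $M^*(x) := M^*(x,1)$. $R_n^*=(\rho_{ij})_{1\le i,j\le n}$ is the $n\times n$ matrix with $\rho_{ij}=1$ if $i \parallel j$ or $j=1$, and $\rho_{ij}=0$ otherwise. $S_n=(s_{ij})$ is the $n\times n$ matrix with $s_{ij}=1$ if $i\parallel j$ and $0$ otherwise. $T_n=(t_{ij})$ is the $n\times n$ matrix with $t_{i1}=M^*(n/i,i)$ for all $i$, $t_{ii}=1$ for $i\ge 2$, and $t_{ij}=0$ otherwise. -}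

module Defs where

open import Data.Bool.Base using (if_then_else_)
open import Data.Fin.Base using (Fin; zero; suc; toℕ; punchIn)
open import Data.Integer.Base using (ℤ; +_; 0ℤ; 1ℤ; -1ℤ; _*_; _^_; ∣_∣)
open import Data.Integer.Properties using (+-*-semiring)
open import Data.List.Base using (length; filter; upTo)
open import Data.Nat.Base using (ℕ; zero; suc; NonZero; _/_)
open import Data.Nat.Divisibility using (_∣_; _∣?_)
open import Data.Nat.GCD using (gcd)
open import Data.Nat.Primality using (prime?)
open import Data.Product.Base using (_×_)
open import Data.Rational.Unnormalised.Base as ℚᵘ using (ℚᵘ; floor)
open import Relation.Binary.PropositionalEquality.Core using (_≡_)
open import Relation.Nullary.Decidable.Core using (Dec; does; _×-dec_; _⊎-dec_)
import Data.Fin.Properties as Fin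
import Data.Nat.Properties as ℕ

open import Algebra.Properties.Semiring.Sum +-*-semiring public using (sum)

-- Iverson bracket
⟦_⟧ : ∀ {p} {P : Set p} → Dec P → ℤ
⟦ P? ⟧ = if does P? then 1ℤ else 0ℤ

infix 4 _∥_ _∥?_

_∥_ : (i j : ℕ) .{{_ : NonZero i}} → Set
i ∥ j = (i ∣ j) × (gcd i (j / i) ≡ 1)

_∥?_ : (i j : ℕ) .{{_ : NonZero i}} → Dec (i ∥ j)
i ∥? j = (i ∣? j) ×-dec (gcd i (j / i) ℕ.≟ 1)

-- Intended for m ≥ 1, where every prime factor of m lies in {0, …, m}.
ω : ℕ → ℕ
ω m = length (filter (λ p → prime? p ×-dec (p ∣? m)) (upTo (suc m)))

μ* : ℕ → ℤ
μ* m = -1ℤ ^ ω m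

-- The sum of f k over 1 ≤ k ≤ n.
∑₁ : ℕ → (ℕ → ℤ) → ℤ
∑₁ n f = sum {n} (λ k → f (suc (toℕ k)))

-- M*(x , m), for x > 0 and m ≥ 1: the positive integers k ≤ x are 1, …, ⌊x⌋.
M*⟨_,_⟩ : ℚᵘ → ℕ → ℤ
M*⟨ x , m ⟩ = ∑₁ ∣ floor x ∣ (λ k → if does (gcd k m ℕ.≟ 1) then μ* k else 0ℤ)

M* : ℚᵘ → ℤ
M* x = M*⟨ x , 1 ⟩

Matrix : ℕ → Set
Matrix n = Fin n → Fin n → ℤ

infix 4 _≈ᴹ_
infixl 7 _*ᴹ_

_≈ᴹ_ : ∀ {n} → Matrix n → Matrix n → Set
A ≈ᴹ B = ∀ i j → A i j ≡ B i j

_*ᴹ_ : ∀ {n} → Matrix n → Matrix n → Matrix n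
(A *ᴹ B) i j = sum (λ k → A i k * B k j)

-- Cofactor expansion along the first column.
det : ∀ {n} → Matrix n → ℤ
det {zero}  A = 1ℤ
det {suc n} A = sum (λ i → -1ℤ ^ toℕ i * A i zero * det (λ r c → A (punchIn i r) (suc c)))

-- Rows and columns are numbered from 1: the index i : Fin n stands for idx i.
idx : ∀ {n} → Fin n → ℕ
idx i = suc (toℕ i)

R* : ∀ n → Matrix n
R* n i j = ⟦ (idx i ∥? idx j) ⊎-dec (idx j ℕ.≟ 1) ⟧

S : ∀ n → Matrix n
S n i j = ⟦ idx i ∥? idx j ⟧

T : ∀ n → Matrix n
T n i zero      = M*⟨ + n ℚᵘ./ idx i , idx i ⟩
T n i j@(suc _) = ⟦ i Fin.≟ j ⟧

{-# OPTIONS --safe #-}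
module Submission where

-- For j ≥ 2 column j of T is a unit vector, so only the first column of S T needs an argument: there, grouping
-- the pairs (k , d) with d ≤ n / k by m = k d, the entry in row i is the sum over m ≤ n of
--   Σ { μ* (m / k) : i ∥ k ∥ m },
-- which is 1 for m = i and 0 otherwise: if i ∥ m and i ≠ m, let q be the exact power in m of a prime p dividing
-- m / i; multiplying or dividing k by q is a fixed-point-free involution on the k with i ∥ k ∥ m which flips the
-- sign of μ* (m / k).
-- The factorisation exhibits the first column of R* as M*(n) e₁ plus a combination of the other columns, which
-- are those of the upper unitriangular matrix S; hence det R* = M*(n).

open import Defs
open import Data.Bool.Base using (if_then_else_; true; false)
open import Data.Fin.Base using (Fin; zero; suc; toℕ; fromℕ; fromℕ<; inject₁; punchIn)
open import Data.Fin.Permutation using (permutation)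
import Data.Fin.Properties as Fin
open import Data.Integer.Base using (ℤ; +_; 0ℤ; 1ℤ; -1ℤ; _+_; _*_; _^_; -_; _-_; ∣_∣)
import Data.Integer.Properties as ℤ
open import Data.Integer.Tactic.RingSolver using (solve-∀)
open import Data.List.Base using ([]; _∷_; [_]; _++_; length; filter; upTo)
import Data.List.Properties as List
open import Data.List.Relation.Unary.All using (_∷_)
open import Data.Nat.Base as ℕ using (ℕ; zero; suc; NonZero; _≤_; s≤s; z<s; s<s)
open import Data.Nat.Coprimality as Coprimality using (Coprime; coprime-divisor; coprime⇒gcd≡1; gcd≡1⇒coprime)
open import Data.Nat.Divisibility
open import Data.Nat.DivMod using (m*n/n≡m; m*[n/m]≡n; /-monoˡ-≤; m<n*o⇒m/o<n; m≡m%n+[m/n]*n; m%n<n; m/n*n≤m; n/1≡n; n/n≡1)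
open import Data.Nat.GCD using (gcd; gcd-comm)
open import Data.Nat.Induction using (<-wellFounded)
open import Data.Nat.Primality using (Prime; prime?; euclidsLemma; prime⇒irreducible; prime⇒nonZero; prime⇒nonTrivial; ¬prime[1])
open import Data.Nat.Primality.Factorisation using (factorise)
import Data.Nat.Properties as ℕ
open import Data.Product.Base using (∃-syntax; _×_; _,_; proj₁; proj₂)
open import Data.Rational.Unnormalised.Base using (floor; _/_)
open import Data.Sum.Base using (inj₁; inj₂; [_,_]′)
open import Function.Base using (_∘_; id)
open import Function.Bundles using (_⇔_; mk⇔)
open import Induction.WellFounded using (Acc; acc)
open import Relation.Binary.PropositionalEquality hiding ([_])
open import Relation.Nullary.Decidable using (Dec; does; yes; no; dec-true; dec-false; does-⇔; _×-dec_; _⊎-dec_)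
open import Relation.Nullary.Negation using (¬_; contradiction)
open import Relation.Unary using (Pred; Decidable)
open import Algebra.Properties.Semiring.Sum ℤ.+-*-semiring using (sum-cong-≗; sum-replicate-zero; sum-init-last; sum-permute; ∑-distrib-+; ∑-comm; *-distribˡ-sum)
open ≡-Reasoning

sum-zero : ∀ {n} {f : Fin n → ℤ} → (∀ i → f i ≡ 0ℤ) → sum f ≡ 0ℤ
sum-zero {n} f≡0 = trans (sum-cong-≗ f≡0) (sum-replicate-zero n)

sum-linear : ∀ {n} c (f g : Fin n → ℤ) → sum (λ i → f i + c * g i) ≡ sum f + c * sum g
sum-linear c f g = trans (∑-distrib-+ f (λ i → c * g i)) (cong (_+_ (sum f)) (sym (*-distribˡ-sum c g)))

-- Determinants

minor : ∀ {n} → Matrix (suc n) → Fin (suc n) → Matrix n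
minor A i r c = A (punchIn i r) (suc c)

det-cong : ∀ {n} {A B : Matrix n} → A ≈ᴹ B → det A ≡ det B
det-cong {zero}  A≈B = refl
det-cong {suc n} A≈B = sum-cong-≗ λ i → cong₂ _*_
  (cong (-1ℤ ^ toℕ i *_) (A≈B i zero))
  (det-cong (λ r c → A≈B (punchIn i r) (suc c)))

-- Induction along the first-column expansion: the minor at row 0 omits the row that varies, and
-- every other minor still has it as its own row 0.
det-linear-row₀ : ∀ {n} x (A B C : Matrix (suc n)) →
  (∀ j → A zero j ≡ B zero j + x * C zero j) →
  (∀ i j → A (suc i) j ≡ B (suc i) j) → (∀ i j → A (suc i) j ≡ C (suc i) j) →
  det A ≡ det B + x * det C
det-linear-row₀ {n} x A B C row₀ A≈B A≈C = begin
  det A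
    ≡⟨ sum-cong-≗ cofactor-linear ⟩
  sum (λ i → cofactor B i + x * cofactor C i)
    ≡⟨ sum-linear x (cofactor B) (cofactor C) ⟩
  det B + x * det C ∎
  where
  cofactor : Matrix (suc n) → Fin (suc n) → ℤ
  cofactor D i = -1ℤ ^ toℕ i * D i zero * det (minor D i)

  distrib₀ : ∀ x b c d → 1ℤ * (b + x * c) * d ≡ 1ℤ * b * d + x * (1ℤ * c * d)
  distrib₀ = solve-∀

  distrib : ∀ x s a d e → s * a * (d + x * e) ≡ s * a * d + x * (s * a * e)
  distrib = solve-∀

  cofactor-linear : ∀ i → cofactor A i ≡ cofactor B i + x * cofactor C i
  cofactor-linear zero = begin
    1ℤ * A zero zero * det (minor A zero)
      ≡⟨ cong (λ a → 1ℤ * a * det (minor A zero)) (row₀ zero) ⟩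
    1ℤ * (B zero zero + x * C zero zero) * det (minor A zero)
      ≡⟨ distrib₀ x (B zero zero) (C zero zero) _ ⟩
    1ℤ * B zero zero * det (minor A zero) + x * (1ℤ * C zero zero * det (minor A zero))
      ≡⟨ cong₂ (λ d e → 1ℤ * B zero zero * d + x * (1ℤ * C zero zero * e))
           (det-cong (λ r c → A≈B r (suc c))) (det-cong (λ r c → A≈C r (suc c))) ⟩
    cofactor B zero + x * cofactor C zero ∎
  -- Matching the size as `suc _` exposes the row 0 of the minor that the recursive call requires.
  cofactor-linear (suc {n = suc _} i) = begin
    cofactor A (suc i)
      ≡⟨ cong (s * A (suc i) zero *_)
           (det-linear-row₀ x (minor A (suc i)) (minor B (suc i)) (minor C (suc i))
             (row₀ ∘ suc) (λ r c → A≈B (punchIn i r) (suc c)) (λ r c → A≈C (punchIn i r) (suc c))) ⟩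
    s * A (suc i) zero * (det (minor B (suc i)) + x * det (minor C (suc i)))
      ≡⟨ distrib x s (A (suc i) zero) _ _ ⟩
    s * A (suc i) zero * det (minor B (suc i)) + x * (s * A (suc i) zero * det (minor C (suc i)))
      ≡⟨ cong₂ (λ b c → s * b * det (minor B (suc i)) + x * (s * c * det (minor C (suc i)))) (A≈B i zero) (A≈C i zero) ⟩
    cofactor B (suc i) + x * cofactor C (suc i) ∎
    where s = -1ℤ ^ toℕ (suc i)

a≡0⇒s*a*d≡0 : ∀ s {a} d → a ≡ 0ℤ → s * a * d ≡ 0ℤ
a≡0⇒s*a*d≡0 s d refl = cong (_* d) (ℤ.*-zeroʳ s)

det-col₀-single : ∀ {n} {A : Matrix (suc n)} → (∀ i → A (suc i) zero ≡ 0ℤ) →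
  det A ≡ A zero zero * det (minor A zero)
det-col₀-single {n} {A} below = begin
  1ℤ * A zero zero * det (minor A zero) + sum (λ i → -1ℤ ^ suc (toℕ i) * A (suc i) zero * det (minor A (suc i)))
    ≡⟨ cong₂ _+_ (cong (_* det (minor A zero)) (ℤ.*-identityˡ (A zero zero)))
         (sum-zero λ i → a≡0⇒s*a*d≡0 (-1ℤ ^ suc (toℕ i)) _ (below i)) ⟩
  A zero zero * det (minor A zero) + 0ℤ
    ≡⟨ ℤ.+-identityʳ _ ⟩
  A zero zero * det (minor A zero) ∎

det-col₀-double : ∀ {n} {A : Matrix (suc (suc n))} → (∀ i → A (suc (suc i)) zero ≡ 0ℤ) →
  det A ≡ A zero zero * det (minor A zero) - A (suc zero) zero * det (minor A (suc zero))
det-col₀-double {n} {A} below = begin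
  1ℤ * A zero zero * d₀ + (-1ℤ * 1ℤ * A (suc zero) zero * d₁ +
    sum (λ i → -1ℤ ^ suc (suc (toℕ i)) * A (suc (suc i)) zero * det (minor A (suc (suc i)))))
    ≡⟨ cong (λ z → 1ℤ * A zero zero * d₀ + (-1ℤ * 1ℤ * A (suc zero) zero * d₁ + z)) (sum-zero λ i →
         a≡0⇒s*a*d≡0 (-1ℤ ^ suc (suc (toℕ i))) _ (below i)) ⟩
  1ℤ * A zero zero * d₀ + (-1ℤ * 1ℤ * A (suc zero) zero * d₁ + 0ℤ)
    ≡⟨ tidy (A zero zero) d₀ (A (suc zero) zero) d₁ ⟩
  A zero zero * d₀ - A (suc zero) zero * d₁ ∎
  where
  d₀ = det (minor A zero)
  d₁ = det (minor A (suc zero))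
  tidy : ∀ a d b e → 1ℤ * a * d + (-1ℤ * 1ℤ * b * e + 0ℤ) ≡ a * d - b * e
  tidy = solve-∀

record UnitUpper {n} (A : Matrix n) : Set where
  field
    diag  : ∀ i → A i i ≡ 1ℤ
    below : ∀ i j → toℕ j ℕ.< toℕ i → A i j ≡ 0ℤ

open UnitUpper

unitUpper-minor₀ : ∀ {n} {A : Matrix (suc n)} → UnitUpper A → UnitUpper (minor A zero)
unitUpper-minor₀ U .diag i        = U .diag (suc i)
unitUpper-minor₀ U .below i j j<i = U .below (suc i) (suc j) (s<s j<i)

det-unitUpper : ∀ {n} {A : Matrix n} → UnitUpper A → det A ≡ 1ℤ
det-unitUpper {zero}      U = refl
det-unitUpper {suc n} {A} U = begin
  det A                            ≡⟨ det-col₀-single {A = A} (λ i → U .below (suc i) zero z<s) ⟩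
  A zero zero * det (minor A zero) ≡⟨ cong₂ _*_ (U .diag zero) (det-unitUpper (unitUpper-minor₀ U)) ⟩
  1ℤ ∎

-- When column 1 is (A₀₁ , 1 , 0 , …), a row operation makes it a unit vector, and row 1 and column 1 drop out.
clear : ∀ {n} → Matrix (suc (suc n)) → Matrix (suc n)
clear A zero    j = A zero (punchIn (suc zero) j) - A zero (suc zero) * A (suc zero) (punchIn (suc zero) j)
clear A (suc i) j = A (suc (suc i)) (punchIn (suc zero) j)

-- Deleting column 0 and a row after row 1 leaves a first column (b , 1 , 0 , ...), so two terms
-- survive the expansion, and linearity in row 0 recognises them as the minor of `clear A`. The
-- minus sign comes from the pivot 1 standing in row 1; it offsets the shift of row indices in
-- `det-clear`.
det-minor-clear : ∀ {n} (A : Matrix (suc (suc n))) → UnitUpper (minor A zero) →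
  ∀ i → det (minor A (suc (suc i))) ≡ - det (minor (clear A) (suc i))
det-minor-clear {suc n} A U i = begin
  det M
    ≡⟨ det-col₀-double {A = M} (λ r → U .below (suc (punchIn i r)) zero z<s) ⟩
  b * det (minor M zero) - A (suc zero) (suc zero) * det (minor M (suc zero))
    ≡⟨ cong (λ d → b * det (minor M zero) - d * det (minor M (suc zero))) (U .diag zero) ⟩
  b * det (minor M zero) - 1ℤ * det (minor M (suc zero))
    ≡⟨ negate b (det (minor M zero)) (det (minor M (suc zero))) ⟩
  - (det (minor M (suc zero)) + - b * det (minor M zero))
    ≡⟨ cong -_ (det-linear-row₀ (- b) (minor (clear A) (suc i)) (minor M (suc zero)) (minor M zero)
         (λ j → expand (A zero (suc (suc j))) b (A (suc zero) (suc (suc j)))) (λ _ _ → refl) (λ _ _ → refl)) ⟨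
  - det (minor (clear A) (suc i)) ∎
  where
  M = minor A (suc (suc i))
  b = A zero (suc zero)

  negate : ∀ b x y → b * x - 1ℤ * y ≡ - (y + - b * x)
  negate = solve-∀

  expand : ∀ a b c → a - b * c ≡ a + - b * c
  expand = solve-∀

-- The two first-column expansions are compared term by term: rows 0 and 1 of `A` together give row
-- 0 of `clear A`, and each later row gives the row one place higher.
det-clear : ∀ {n} (A : Matrix (suc (suc n))) → UnitUpper (minor A zero) → det A ≡ det (clear A)
det-clear {n} A U = begin
  1ℤ * A zero zero * det (minor A zero) + (-1ℤ * 1ℤ * A (suc zero) zero * det (minor A (suc zero)) + rest)
    ≡⟨ cong₂ (λ d e → 1ℤ * A zero zero * d + (-1ℤ * 1ℤ * A (suc zero) zero * e + rest)) (det-unitUpper U) minor₁ ⟩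
  1ℤ * A zero zero * 1ℤ + (-1ℤ * 1ℤ * A (suc zero) zero * b + rest)
    ≡⟨ cong (λ z → 1ℤ * A zero zero * 1ℤ + (-1ℤ * 1ℤ * A (suc zero) zero * b + z)) (sum-cong-≗ minor₂) ⟩
  1ℤ * A zero zero * 1ℤ + (-1ℤ * 1ℤ * A (suc zero) zero * b + rest′)
    ≡⟨ tidy (A zero zero) (A (suc zero) zero) b rest′ ⟩
  1ℤ * (A zero zero - b * A (suc zero) zero) * 1ℤ + rest′
    ≡⟨ cong (λ d → 1ℤ * (A zero zero - b * A (suc zero) zero) * d + rest′) (det-unitUpper U′) ⟨
  det (clear A) ∎
  where
  b = A zero (suc zero)

  rest = sum (λ i → -1ℤ ^ suc (suc (toℕ i)) * A (suc (suc i)) zero * det (minor A (suc (suc i))))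
  rest′ = sum (λ i → -1ℤ ^ suc (toℕ i) * clear A (suc i) zero * det (minor (clear A) (suc i)))

  U′ : UnitUpper (λ r c → A (suc (suc r)) (suc (suc c)))
  U′ = unitUpper-minor₀ U

  minor₁ : det (minor A (suc zero)) ≡ b
  minor₁ = begin
    det (minor A (suc zero))
      ≡⟨ det-col₀-single {A = minor A (suc zero)} (λ i → U .below (suc i) zero z<s) ⟩
    b * det (minor (minor A (suc zero)) zero)
      ≡⟨ cong (b *_) (det-unitUpper U′) ⟩
    b * 1ℤ
      ≡⟨ ℤ.*-identityʳ b ⟩
    b ∎

  signs : ∀ s a d → -1ℤ * s * a * - d ≡ s * a * d
  signs = solve-∀

  tidy : ∀ a c b r → 1ℤ * a * 1ℤ + (-1ℤ * 1ℤ * c * b + r) ≡ 1ℤ * (a - b * c) * 1ℤ + r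
  tidy = solve-∀

  minor₂ : ∀ i → -1ℤ ^ suc (suc (toℕ i)) * A (suc (suc i)) zero * det (minor A (suc (suc i))) ≡
                 -1ℤ ^ suc (toℕ i) * clear A (suc i) zero * det (minor (clear A) (suc i))
  minor₂ i = begin
    -1ℤ * s * A (suc (suc i)) zero * det (minor A (suc (suc i)))
      ≡⟨ cong (-1ℤ * s * A (suc (suc i)) zero *_) (det-minor-clear A U i) ⟩
    -1ℤ * s * A (suc (suc i)) zero * - det (minor (clear A) (suc i))
      ≡⟨ signs s (A (suc (suc i)) zero) _ ⟩
    s * clear A (suc i) zero * det (minor (clear A) (suc i)) ∎
    where s = -1ℤ ^ suc (toℕ i)

-- Subtracting the `t`-combination of the later columns would leave u e₀ in column 0. Instead of
-- column operations, the induction applies `clear`, which drops column 1 with its coefficient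
-- `t zero` and preserves `u`.
det-combination : ∀ {n} (A : Matrix (suc n)) (u : ℤ) (t : Fin n → ℤ) →
  UnitUpper (minor A zero) →
  A zero zero ≡ u + sum (λ k → A zero (suc k) * t k) →
  (∀ i → A (suc i) zero ≡ sum (λ k → A (suc i) (suc k) * t k)) →
  det A ≡ u
det-combination {zero} A u t U top rest = begin
  1ℤ * A zero zero * 1ℤ + 0ℤ ≡⟨ cong (λ a → 1ℤ * a * 1ℤ + 0ℤ) top ⟩
  1ℤ * (u + 0ℤ) * 1ℤ + 0ℤ    ≡⟨ tidy u ⟩
  u ∎
  where
  tidy : ∀ u → 1ℤ * (u + 0ℤ) * 1ℤ + 0ℤ ≡ u
  tidy = solve-∀
det-combination {suc n} A u t U top rest =
  trans (det-clear A U) (det-combination (clear A) u (t ∘ suc) (unitUpper-minor₀ U) top′ rest′)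
  where
  b = A zero (suc zero)
  f = λ k → A zero (suc (suc k)) * t (suc k)
  g = λ k → A (suc zero) (suc (suc k)) * t (suc k)

  cancel : ∀ u b t x y → u + (b * t + x) - b * (1ℤ * t + y) ≡ u + (x + - b * y)
  cancel = solve-∀

  factor : ∀ a b c t → a * t + - b * (c * t) ≡ (a - b * c) * t
  factor = solve-∀

  top′ : A zero zero - b * A (suc zero) zero ≡ u + sum (λ k → clear A zero (suc k) * t (suc k))
  top′ = begin
    A zero zero - b * A (suc zero) zero
      -- By `rest zero` and the unit diagonal, entry (1 , 0) is `t zero` plus a tail, so the row
      -- operation cancels `b * t zero`.
      ≡⟨ cong₂ (λ x y → x - b * y) top (trans (rest zero) (cong (λ d → d * t zero + sum g) (U .diag zero))) ⟩
    u + (b * t zero + sum f) - b * (1ℤ * t zero + sum g)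
      ≡⟨ cancel u b (t zero) (sum f) (sum g) ⟩
    u + (sum f + - b * sum g)
      ≡⟨ cong (_+_ u) (sum-linear (- b) f g) ⟨
    u + sum (λ k → f k + - b * g k)
      ≡⟨ cong (_+_ u) (sum-cong-≗ λ k → factor (A zero (suc (suc k))) b (A (suc zero) (suc (suc k))) (t (suc k))) ⟩
    u + sum (λ k → clear A zero (suc k) * t (suc k)) ∎

  rest′ : ∀ i → A (suc (suc i)) zero ≡ sum (λ k → A (suc (suc i)) (suc (suc k)) * t (suc k))
  rest′ i = begin
    A (suc (suc i)) zero
      ≡⟨ rest (suc i) ⟩
    A (suc (suc i)) (suc zero) * t zero + tail
      ≡⟨ cong (λ z → z * t zero + tail) (U .below (suc i) zero z<s) ⟩
    0ℤ * t zero + tail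
      ≡⟨ ℤ.+-identityˡ tail ⟩
    tail ∎
    where tail = sum (λ k → A (suc (suc i)) (suc (suc k)) * t (suc k))

-- Finite sums

⟦⟧-true : ∀ {a} {A : Set a} (a? : Dec A) → A → ⟦ a? ⟧ ≡ 1ℤ
⟦⟧-true a? a = cong (if_then 1ℤ else 0ℤ) (dec-true a? a)

⟦⟧-false : ∀ {a} {A : Set a} (a? : Dec A) → ¬ A → ⟦ a? ⟧ ≡ 0ℤ
⟦⟧-false a? ¬a = cong (if_then 1ℤ else 0ℤ) (dec-false a? ¬a)

⟦⟧-⇔ : ∀ {a b} {A : Set a} {B : Set b} → A ⇔ B → (a? : Dec A) (b? : Dec B) → ⟦ a? ⟧ ≡ ⟦ b? ⟧
⟦⟧-⇔ A⇔B a? b? = cong (if_then 1ℤ else 0ℤ) (does-⇔ A⇔B a? b?)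

sum-δ : ∀ {n} (f : Fin n → ℤ) i → sum (λ k → f k * ⟦ k Fin.≟ i ⟧) ≡ f i
sum-δ f zero = begin
  f zero * 1ℤ + sum (λ k → f (suc k) * 0ℤ)
    ≡⟨ cong₂ _+_ (ℤ.*-identityʳ (f zero)) (sum-zero λ k → ℤ.*-zeroʳ (f (suc k))) ⟩
  f zero + 0ℤ
    ≡⟨ ℤ.+-identityʳ (f zero) ⟩
  f zero ∎
sum-δ f (suc i) = begin
  f zero * 0ℤ + sum (λ k → f (suc k) * ⟦ k Fin.≟ i ⟧)
    ≡⟨ cong₂ _+_ (ℤ.*-zeroʳ (f zero)) (sum-δ (f ∘ suc) i) ⟩
  0ℤ + f (suc i)
    ≡⟨ ℤ.+-identityˡ (f (suc i)) ⟩
  f (suc i) ∎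

i+i≡0⇒i≡0 : ∀ i → i + i ≡ 0ℤ → i ≡ 0ℤ
-- For the other integers the double reduces to a visibly nonzero form, so the equation is absurd.
i+i≡0⇒i≡0 (+ 0) _ = refl

-- Fixed points k ~ k are allowed: there f k + f k ≡ 0ℤ forces f k ≡ 0ℤ.
sum-matching : ∀ {n} (f : Fin n → ℤ) (_~_ : Fin n → Fin n → Set) →
  (∀ k → ∃[ l ] k ~ l) →
  (∀ {k l} → k ~ l → l ~ k) →
  (∀ {k l l′} → k ~ l → k ~ l′ → l ≡ l′) →
  (∀ {k l} → k ~ l → f k + f l ≡ 0ℤ) →
  sum f ≡ 0ℤ
sum-matching {n} f _~_ total ~-sym ~-functional cancels = i+i≡0⇒i≡0 (sum f) (begin
  sum f + sum f                ≡⟨ cong (_+_ (sum f)) (sum-permute f (permutation σ σ σ-involutive σ-involutive)) ⟩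
  sum f + sum (λ k → f (σ k))  ≡⟨ ∑-distrib-+ f (f ∘ σ) ⟨
  sum (λ k → f k + f (σ k))    ≡⟨ sum-zero (λ k → cancels (proj₂ (total k))) ⟩
  0ℤ ∎)
  where
  σ : Fin n → Fin n
  σ = proj₁ ∘ total

  σ-involutive : ∀ k → σ (σ k) ≡ k
  σ-involutive k = ~-functional (proj₂ (total (σ k))) (~-sym (proj₂ (total k)))

∑₁-suc : ∀ n f → ∑₁ (suc n) f ≡ ∑₁ n f + f (suc n)
∑₁-suc n f = begin
  ∑₁ (suc n) f
    ≡⟨ sum-init-last {n} (λ k → f (suc (toℕ k))) ⟩
  sum {n} (λ k → f (suc (toℕ (inject₁ k)))) + f (suc (toℕ (fromℕ n)))
    ≡⟨ cong₂ _+_ (sum-cong-≗ {n} (λ k → cong (f ∘ suc) (Fin.toℕ-inject₁ k))) (cong (f ∘ suc) (Fin.toℕ-fromℕ n)) ⟩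
  ∑₁ n f + f (suc n) ∎

m<[1+m/n]*n : ∀ m n .{{_ : NonZero n}} → m ℕ.< suc (m ℕ./ n) ℕ.* n
m<[1+m/n]*n m n = subst (ℕ._< suc (m ℕ./ n) ℕ.* n) (sym (m≡m%n+[m/n]*n m n)) (ℕ.+-monoˡ-< _ (m%n<n m n))

/-unique : ∀ {m} n q .{{_ : NonZero n}} → q ℕ.* n ℕ.≤ m → m ℕ.< suc q ℕ.* n → m ℕ./ n ≡ q
/-unique {m} n q lower upper = ℕ.≤-antisym
  (ℕ.s≤s⁻¹ (m<n*o⇒m/o<n upper))
  (subst (ℕ._≤ m ℕ./ n) (m*n/n≡m q n) (/-monoˡ-≤ n lower))

-- Substitute m = k d. The induction on `n` rests on the quotient growing by one exactly when
-- `suc n` is a multiple of `k`.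
∑₁-dilate : ∀ k .{{_ : NonZero k}} n f → ∑₁ (n ℕ./ k) f ≡ ∑₁ n (λ m → ⟦ k ∣? m ⟧ * f (m ℕ./ k))
-- The quotient of 0 reduces only once `k` is a visible successor.
∑₁-dilate (suc _) zero f = refl
∑₁-dilate k (suc n) f = begin
  ∑₁ (suc n ℕ./ k) f                        ≡⟨ step (k ∣? suc n) ⟩
  ∑₁ (n ℕ./ k) f + g (suc n)                ≡⟨ cong (_+ g (suc n)) (∑₁-dilate k n f) ⟩
  ∑₁ n g + g (suc n)                        ≡⟨ ∑₁-suc n g ⟨
  ∑₁ (suc n) g ∎
  where
  g : ℕ → ℤ
  g m = ⟦ k ∣? m ⟧ * f (m ℕ./ k)

  step : Dec (k ∣ suc n) → ∑₁ (suc n ℕ./ k) f ≡ ∑₁ (n ℕ./ k) f + g (suc n)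
  step (yes k∣1+n@(divides (suc q) 1+n≡)) = begin
    ∑₁ (suc n ℕ./ k) f
      ≡⟨ cong (λ x → ∑₁ x f) 1+n/k ⟩
    ∑₁ (suc q) f
      ≡⟨ ∑₁-suc q f ⟩
    ∑₁ q f + f (suc q)
      ≡⟨ cong₂ (λ x y → ∑₁ x f + f y) (sym n/k) (sym 1+n/k) ⟩
    ∑₁ (n ℕ./ k) f + f (suc n ℕ./ k)
      ≡⟨ cong (_+_ (∑₁ (n ℕ./ k) f)) (ℤ.*-identityˡ _) ⟨
    ∑₁ (n ℕ./ k) f + 1ℤ * f (suc n ℕ./ k)
      ≡⟨ cong (λ x → ∑₁ (n ℕ./ k) f + x * f (suc n ℕ./ k)) (⟦⟧-true (k ∣? suc n) k∣1+n) ⟨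
    ∑₁ (n ℕ./ k) f + g (suc n) ∎
    where
    1+n/k : suc n ℕ./ k ≡ suc q
    1+n/k = trans (cong (ℕ._/ k) 1+n≡) (m*n/n≡m (suc q) k)
    n/k : n ℕ./ k ≡ q
    n/k = /-unique k q
      (ℕ.s≤s⁻¹ (subst (q ℕ.* k ℕ.<_) (sym 1+n≡) (ℕ.m<n+m (q ℕ.* k) (ℕ.>-nonZero⁻¹ k))))
      (ℕ.≤-reflexive 1+n≡)
  step (no k∤1+n) = begin
    ∑₁ (suc n ℕ./ k) f
      ≡⟨ cong (λ x → ∑₁ x f) 1+n/k ⟩
    ∑₁ (n ℕ./ k) f
      ≡⟨ ℤ.+-identityʳ _ ⟨
    ∑₁ (n ℕ./ k) f + 0ℤ
      ≡⟨ cong (λ x → ∑₁ (n ℕ./ k) f + x * f (suc n ℕ./ k)) (⟦⟧-false (k ∣? suc n) k∤1+n) ⟨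
    ∑₁ (n ℕ./ k) f + g (suc n) ∎
    where
    1+n/k : suc n ℕ./ k ≡ n ℕ./ k
    -- The division bound gives `suc n` at most (1 + n / k) k, and equality would make `k` a divisor
    -- of `suc n`.
    1+n/k = /-unique k (n ℕ./ k) (ℕ.m≤n⇒m≤1+n (m/n*n≤m n k))
      (ℕ.≤∧≢⇒< (m<[1+m/n]*n n k) (k∤1+n ∘ divides (suc (n ℕ./ k))))

-- Counting prime factors

-- `ω m` unfolds to such a count at `suc m`. Freeing the predicate and the bound allows induction on
-- the bound.
count : ∀ {p} {P : Pred ℕ p} → Decidable P → ℕ → ℕ
count P? n = length (filter P? (upTo n))

module _ {p} {P : Pred ℕ p} (P? : Decidable P) where

  private
    count-snoc : ∀ n → count P? (suc n) ≡ count P? n ℕ.+ length (filter P? [ n ])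
    count-snoc n = begin
      length (filter P? (upTo (suc n)))                  ≡⟨ cong (length ∘ filter P?) (List.upTo-∷ʳ n) ⟨
      length (filter P? (upTo n ++ [ n ]))               ≡⟨ cong length (List.filter-++ P? (upTo n) [ n ]) ⟩
      length (filter P? (upTo n) ++ filter P? [ n ])     ≡⟨ List.length-++ (filter P? (upTo n)) ⟩
      count P? n ℕ.+ length (filter P? [ n ]) ∎

  count-accept : ∀ {n} → P n → count P? (suc n) ≡ suc (count P? n)
  count-accept {n} Pn = begin
    count P? (suc n)                            ≡⟨ count-snoc n ⟩
    count P? n ℕ.+ length (filter P? [ n ])     ≡⟨ cong (λ xs → count P? n ℕ.+ length xs) (List.filter-accept P? Pn) ⟩
    count P? n ℕ.+ 1                            ≡⟨ ℕ.+-comm _ 1 ⟩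
    suc (count P? n) ∎

  count-reject : ∀ {n} → ¬ P n → count P? (suc n) ≡ count P? n
  count-reject {n} ¬Pn = begin
    count P? (suc n)                            ≡⟨ count-snoc n ⟩
    count P? n ℕ.+ length (filter P? [ n ])     ≡⟨ cong (λ xs → count P? n ℕ.+ length xs) (List.filter-reject P? ¬Pn) ⟩
    count P? n ℕ.+ 0                            ≡⟨ ℕ.+-identityʳ _ ⟩
    count P? n ∎

  -- Serves to compare values of `ω` whose ranges differ in length. `≤′` recurses at the upper end,
  -- where `count-snoc` splits.
  count-bounded : ∀ {m n} → (∀ {x} → P x → x ℕ.< m) → m ℕ.≤′ n → count P? n ≡ count P? m
  count-bounded bound ℕ.≤′-refl       = refl
  count-bounded bound (ℕ.≤′-step m≤n) =
    trans (count-reject (λ Pn → ℕ.≤⇒≯ (ℕ.≤′⇒≤ m≤n) (bound Pn))) (count-bounded bound m≤n)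

module _ {p q} {P : Pred ℕ p} {Q : Pred ℕ q} (P? : Decidable P) (Q? : Decidable Q) where

  private
    -- One step for two inductions: the offset `c` is 0 for equal counts and 1 once an extra point
    -- has been passed.
    count-step : ∀ {n} c → (P n → Q n) → (Q n → P n) →
                 count Q? n ≡ c ℕ.+ count P? n → count Q? (suc n) ≡ c ℕ.+ count P? (suc n)
    count-step {n} c P⇒Q Q⇒P eq with P? n
    ... | yes Pn = begin
      count Q? (suc n)          ≡⟨ count-accept Q? (P⇒Q Pn) ⟩
      suc (count Q? n)          ≡⟨ cong suc eq ⟩
      suc (c ℕ.+ count P? n)    ≡⟨ ℕ.+-suc c _ ⟨
      c ℕ.+ suc (count P? n)    ≡⟨ cong (c ℕ.+_) (count-accept P? Pn) ⟨
      c ℕ.+ count P? (suc n) ∎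
    ... | no ¬Pn = begin
      count Q? (suc n)          ≡⟨ count-reject Q? (¬Pn ∘ Q⇒P) ⟩
      count Q? n                ≡⟨ eq ⟩
      c ℕ.+ count P? n          ≡⟨ cong (c ℕ.+_) (count-reject P? ¬Pn) ⟨
      c ℕ.+ count P? (suc n) ∎

  count-cong : ∀ n → (∀ {x} → x ℕ.< n → P x → Q x) → (∀ {x} → x ℕ.< n → Q x → P x) → count Q? n ≡ count P? n
  count-cong zero    P⇒Q Q⇒P = refl
  count-cong (suc n) P⇒Q Q⇒P = count-step 0 (P⇒Q ℕ.≤-refl) (Q⇒P ℕ.≤-refl)
    (count-cong n (P⇒Q ∘ ℕ.m<n⇒m<1+n) (Q⇒P ∘ ℕ.m<n⇒m<1+n))

  -- The counts agree below `y`, differ by one after `y` is read, and advance together from then on.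
  count-insert : ∀ {y} → ¬ P y → Q y → (∀ {x} → P x → Q x) → (∀ {x} → x ≢ y → Q x → P x) →
                 ∀ {n} → y ℕ.<′ n → count Q? n ≡ suc (count P? n)
  count-insert {y} ¬Py Qy P⇒Q Q⇒P ℕ.≤′-refl = begin
    count Q? (suc y)    ≡⟨ count-accept Q? Qy ⟩
    suc (count Q? y)    ≡⟨ cong suc (count-cong y (λ _ → P⇒Q) (λ x<y → Q⇒P (ℕ.<⇒≢ x<y))) ⟩
    suc (count P? y)    ≡⟨ cong suc (count-reject P? ¬Py) ⟨
    suc (count P? (suc y)) ∎
  count-insert ¬Py Qy P⇒Q Q⇒P (ℕ.≤′-step y<n) =
    count-step 1 P⇒Q (Q⇒P (ℕ.>⇒≢ (ℕ.≤′⇒≤ y<n))) (count-insert ¬Py Qy P⇒Q Q⇒P y<n)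

-- Prime powers: coprimality, exact powers and their effect on `ω`

coprime-* : ∀ {a b c} → Coprime a c → Coprime b c → Coprime (a ℕ.* b) c
coprime-* {a} a⊥c b⊥c {d} (d∣ab , d∣c) = b⊥c (coprime-divisor d⊥a d∣ab , d∣c)
  where
  d⊥a : Coprime d a
  d⊥a (e∣d , e∣a) = a⊥c (e∣a , ∣-trans e∣d d∣c)

coprime-∣ʳ : ∀ {a b c} → b ∣ c → Coprime a c → Coprime a b
coprime-∣ʳ b∣c a⊥c (d∣a , d∣b) = a⊥c (d∣a , ∣-trans d∣b b∣c)

prime∣prime⇒≡ : ∀ {p r} → Prime p → Prime r → r ∣ p → r ≡ p
prime∣prime⇒≡ pp pr r∣p with prime⇒irreducible pp r∣p
... | inj₁ refl = contradiction pr ¬prime[1]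
... | inj₂ r≡p  = r≡p

prime∣^⇒∣ : ∀ {p x} → Prime p → ∀ a → p ∣ x ℕ.^ a → p ∣ x
prime∣^⇒∣ pp zero    p∣1 = contradiction (subst Prime (∣1⇒≡1 p∣1) pp) ¬prime[1]
prime∣^⇒∣ {x = x} pp (suc a) p∣x*xᵃ = [ id , prime∣^⇒∣ pp a ]′ (euclidsLemma x (x ℕ.^ a) pp p∣x*xᵃ)

prime^-coprime : ∀ {p x} → Prime p → p ∤ x → ∀ a → Coprime (p ℕ.^ a) x
prime^-coprime {x = x} pp p∤x zero = Coprimality.1-coprimeTo x
prime^-coprime {p} {x} pp p∤x (suc a) = coprime-* p⊥x (prime^-coprime pp p∤x a)
  where
  p⊥x : Coprime p x
  p⊥x (d∣p , d∣x) with prime⇒irreducible pp d∣p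
  ... | inj₁ d≡1  = d≡1
  ... | inj₂ refl = contradiction d∣x p∤x

prime-power-part : ∀ {p} → Prime p → ∀ n .{{_ : NonZero n}} → ∃[ a ] ∃[ r ] n ≡ p ℕ.^ a ℕ.* r × p ∤ r
prime-power-part {p} pp n = go n (<-wellFounded n)
  where
  go : ∀ n .{{_ : NonZero n}} → Acc ℕ._<_ n → ∃[ a ] ∃[ r ] n ≡ p ℕ.^ a ℕ.* r × p ∤ r
  go n (acc smaller) with p ∣? n
  ... | no  p∤n = 0 , n , sym (ℕ.*-identityˡ n) , p∤n
  ... | yes (divides (suc c) refl) with go (suc c) (smaller (ℕ.m<m*n (suc c) p (ℕ.nonTrivial⇒n>1 p {{prime⇒nonTrivial pp}})))
  ...   | a , r , c≡ , p∤r = suc a , r , eq , p∤r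
    where
    eq : suc c ℕ.* p ≡ p ℕ.* p ℕ.^ a ℕ.* r
    eq = begin
      suc c ℕ.* p              ≡⟨ ℕ.*-comm (suc c) p ⟩
      p ℕ.* suc c              ≡⟨ cong (p ℕ.*_) c≡ ⟩
      p ℕ.* (p ℕ.^ a ℕ.* r)    ≡⟨ ℕ.*-assoc p (p ℕ.^ a) r ⟨
      p ℕ.* p ℕ.^ a ℕ.* r ∎

prime-factor : ∀ n .{{_ : NonZero n}} → n ≢ 1 → ∃[ p ] Prime p × p ∣ n
prime-factor n n≢1 with factorise n
... | record { factors = [] ; isFactorisation = n≡1 } = contradiction n≡1 n≢1
... | record { factors = p ∷ ps ; isFactorisation = n≡ ; factorsPrime = pp ∷ _ } =
  p , pp , subst (p ∣_) (sym n≡) (m∣m*n _)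

-- The primes dividing q x are those dividing `x` together with the new prime `p`, which counts once
-- whatever its exponent.
ω-prime^-* : ∀ {p} → Prime p → ∀ a x .{{_ : NonZero x}} → p ∤ x → ω (p ℕ.^ suc a ℕ.* x) ≡ suc (ω x)
ω-prime^-* {p} pp a x p∤x = begin
  ω (q ℕ.* x)
    -- Both predicates are first counted over the range for q x; the next step shortens the range
    -- for `x`.
    ≡⟨ count-insert (primeFactor? x) (primeFactor? (q ℕ.* x)) (p∤x ∘ proj₂) (pp , p∣qx)
         (λ (pr , r∣x) → pr , ∣n⇒∣m*n q r∣x) other (ℕ.≤⇒≤′ (s≤s (∣⇒≤ p∣qx))) ⟩
  suc (count (primeFactor? x) (suc (q ℕ.* x)))
    ≡⟨ cong suc (count-bounded (primeFactor? x) (λ (_ , r∣x) → s≤s (∣⇒≤ r∣x)) (ℕ.≤⇒≤′ (s≤s (ℕ.m≤n*m x q)))) ⟩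
  suc (ω x) ∎
  where
  q = p ℕ.^ suc a

  instance
    p≢0 : NonZero p
    p≢0 = prime⇒nonZero pp
    q≢0 : NonZero q
    q≢0 = ℕ.m^n≢0 p (suc a)
    qx≢0 : NonZero (q ℕ.* x)
    qx≢0 = ℕ.m*n≢0 q x

  primeFactor? : ∀ m → Decidable (λ r → Prime r × r ∣ m)
  primeFactor? m r = prime? r ×-dec (r ∣? m)

  p∣qx : p ∣ q ℕ.* x
  p∣qx = ∣m⇒∣m*n x (m∣m*n (p ℕ.^ a))

  other : ∀ {r} → r ≢ p → Prime r × r ∣ q ℕ.* x → Prime r × r ∣ x
  other r≢p (pr , r∣qx) with euclidsLemma q x pr r∣qx
  ... | inj₁ r∣q = contradiction (prime∣prime⇒≡ pp pr (prime∣^⇒∣ pr (suc a) r∣q)) r≢p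
  ... | inj₂ r∣x = pr , r∣x

μ*-prime^-* : ∀ {p} → Prime p → ∀ a x .{{_ : NonZero x}} → p ∤ x → μ* (p ℕ.^ suc a ℕ.* x) ≡ - μ* x
μ*-prime^-* pp a x p∤x = trans (cong (-1ℤ ^_) (ω-prime^-* pp a x p∤x)) (ℤ.-1*i≡-i (μ* x))

-- Unitary divisors

-- k ∥ m without the division: m = k l with k and l coprime.
_∥[_]_ : ℕ → ℕ → ℕ → Set
k ∥[ l ] m = m ≡ k ℕ.* l × Coprime k l

∥⇒∥[] : ∀ {k m} .{{_ : NonZero k}} → k ∥ m → k ∥[ m ℕ./ k ] m
∥⇒∥[] (k∣m , gcd≡1) = sym (m*[n/m]≡n k∣m) , gcd≡1⇒coprime gcd≡1

∥[]⇒/≡ : ∀ {k l m} .{{_ : NonZero k}} → k ∥[ l ] m → m ℕ./ k ≡ l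
∥[]⇒/≡ {k} {l} (m≡kl , _) = trans (cong (ℕ._/ k) (trans m≡kl (ℕ.*-comm k l))) (m*n/n≡m l k)

∥[]⇒∥ : ∀ {k l m} .{{_ : NonZero k}} → k ∥[ l ] m → k ∥ m
∥[]⇒∥ {k} {l} k∥m@(m≡kl , k⊥l) =
  subst (k ∣_) (sym m≡kl) (m∣m*n l) , trans (cong (gcd k) (∥[]⇒/≡ k∥m)) (coprime⇒gcd≡1 k⊥l)

∥-refl : ∀ k .{{_ : NonZero k}} → k ∥ k
∥-refl k = ∥[]⇒∥ (sym (ℕ.*-identityʳ k) , Coprimality.sym (Coprimality.1-coprimeTo k))

-- Write k = i e and m = k l. Then m = i (e l), and `i` is coprime to `e` by the first relation and
-- to `l` because it divides `k`.
∥-trans : ∀ {i k m} .{{_ : NonZero i}} .{{_ : NonZero k}} → i ∥ k → k ∥ m → i ∥ m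
∥-trans {i} {k} {m} i∥k k∥m with ∥⇒∥[] i∥k | ∥⇒∥[] k∥m
... | k≡ie , i⊥e | m≡kl , k⊥l = ∥[]⇒∥ (m≡iel , Coprimality.sym (coprime-* (Coprimality.sym i⊥e) (Coprimality.sym i⊥l)))
  where
  e = k ℕ./ i
  l = m ℕ./ k

  m≡iel : m ≡ i ℕ.* (e ℕ.* l)
  m≡iel = begin
    m                  ≡⟨ m≡kl ⟩
    k ℕ.* l            ≡⟨ cong (ℕ._* l) k≡ie ⟩
    i ℕ.* e ℕ.* l      ≡⟨ ℕ.*-assoc i e l ⟩
    i ℕ.* (e ℕ.* l) ∎

  i⊥l : Coprime i l
  i⊥l (d∣i , d∣l) = k⊥l (∣-trans d∣i (proj₁ i∥k) , d∣l)

-- Toggling produces divisors of `idx m`; these are at most `idx m`, hence again name a row or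
-- column.
idx-surjective : ∀ {n} k (m : Fin n) .{{_ : NonZero k}} → k ∣ idx m → ∃[ l ] idx {n} l ≡ k
idx-surjective (suc k) m k∣m = fromℕ< k<n , cong suc (Fin.toℕ-fromℕ< k<n)
  where k<n = ℕ.<-≤-trans (∣⇒≤ k∣m) (Fin.toℕ<n m)

idx-injective : ∀ {n} {k l : Fin n} → idx k ≡ idx l → k ≡ l
idx-injective = Fin.toℕ-injective ∘ ℕ.suc-injective

-- Multiplication by q = p ^ suc a matches the k with p ∤ k and i ∥ k ∥ m with those with p ∣ k, when q is the
-- exact power of p in m and p ∤ i.
module Toggle {p} (pp : Prime p) (a : ℕ) {i m m′ : ℕ} .{{_ : NonZero m}}
  (m≡ : m ≡ p ℕ.^ suc a ℕ.* m′) (p∤m′ : p ∤ m′) (p∤i : p ∤ i) where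

  q = p ℕ.^ suc a

  instance
    q≢0 : NonZero q
    q≢0 = ℕ.m^n≢0 p (suc a) {{prime⇒nonZero pp}}

  q⊥_ : ∀ {x} → p ∤ x → Coprime q x
  q⊥ p∤x = prime^-coprime pp p∤x (suc a)

  p∣q* : ∀ x → p ∣ q ℕ.* x
  p∣q* x = ∣m⇒∣m*n x (m∣m*n (p ℕ.^ a))

  -- Cancelling `q` identifies k l with `m′`, which `p` does not divide.
  cofactor-∤ : ∀ {k l} → m ≡ q ℕ.* (k ℕ.* l) → p ∤ k × p ∤ l
  cofactor-∤ {k} {l} m≡qkl = p∤m′ ∘ subst (p ∣_) kl≡m′ ∘ ∣m⇒∣m*n l , p∤m′ ∘ subst (p ∣_) kl≡m′ ∘ ∣n⇒∣m*n k
    where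
    kl≡m′ : k ℕ.* l ≡ m′
    kl≡m′ = ℕ.*-cancelˡ-≡ (k ℕ.* l) m′ q (trans (sym m≡qkl) m≡)

  divide : ∀ {x y} → p ∤ x → q ∣ x ℕ.* y → ∃[ z ] y ≡ q ℕ.* z
  divide {x} {y} p∤x q∣xy with coprime-divisor (q⊥ p∤x) q∣xy
  ... | divides z y≡zq = z , trans y≡zq (ℕ.*-comm z q)

  q∣m : ∀ {x} → m ≡ x → q ∣ x
  q∣m m≡x = subst (q ∣_) (trans (sym m≡) m≡x) (m∣m*n m′)

  private
    swap-factor : ∀ x y → x ℕ.* (q ℕ.* y) ≡ q ℕ.* (x ℕ.* y)
    swap-factor x y = begin
      x ℕ.* (q ℕ.* y)    ≡⟨ ℕ.*-assoc x q y ⟨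
      x ℕ.* q ℕ.* y      ≡⟨ cong (ℕ._* y) (ℕ.*-comm x q) ⟩
      q ℕ.* x ℕ.* y      ≡⟨ ℕ.*-assoc q x y ⟩
      q ℕ.* (x ℕ.* y) ∎

  -- As p ∤ k, all of `q` divides the complement `l`; moving it across turns k l into (q k) l′.
  -- Coprimality survives because `q` is coprime to `i` and to `l′`.
  multiply : ∀ {e k l} → i ∥[ e ] k → k ∥[ l ] m → p ∤ k →
    i ∥[ q ℕ.* e ] (q ℕ.* k) × ∃[ l′ ] l ≡ q ℕ.* l′ × p ∤ l′ × (q ℕ.* k) ∥[ l′ ] m
  multiply {e} {k} (k≡ie , i⊥e) (m≡kl , k⊥l) p∤k with divide p∤k (q∣m m≡kl)
  ... | l′ , refl =
    ( trans (cong (q ℕ.*_) k≡ie) (sym (swap-factor i e))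
    , Coprimality.sym (coprime-* (q⊥ p∤i) (Coprimality.sym i⊥e)))
    , l′ , refl , p∤l′
    , trans m≡qkl′ (sym (ℕ.*-assoc q k l′))
    , coprime-* (q⊥ p∤l′) (coprime-∣ʳ (n∣m*n q) k⊥l)
    where
    m≡qkl′ : m ≡ q ℕ.* (k ℕ.* l′)
    m≡qkl′ = trans m≡kl (swap-factor k l′)
    p∤l′ : p ∤ l′
    p∤l′ = proj₂ (cofactor-∤ {k} m≡qkl′)

  -- If p ∣ k, coprimality keeps `p` out of `l`, so `q` divides `k`; as p ∤ i, it divides the part
  -- `e` of `k`, and cancelling it there leaves `i` a unitary divisor.
  remove : ∀ {e k l} → i ∥[ e ] k → k ∥[ l ] m → p ∣ k →
    ∃[ k′ ] k ≡ q ℕ.* k′ × p ∤ k′ × (∃[ e′ ] i ∥[ e′ ] k′) × k′ ∥[ q ℕ.* l ] m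
  remove {e} {k} {l} (k≡ie , i⊥e) (m≡kl , k⊥l) p∣k with divide {l} p∤l (q∣m (trans m≡kl (ℕ.*-comm k l)))
    where
    p∤l : p ∤ l
    p∤l p∣l = contradiction (subst Prime (k⊥l (p∣k , p∣l)) pp) ¬prime[1]
  ... | k′ , refl with divide p∤i (subst (q ∣_) k≡ie (m∣m*n k′))
  ...   | e′ , refl = k′ , refl , p∤k′
    , (e′ , ℕ.*-cancelˡ-≡ k′ (i ℕ.* e′) q (trans k≡ie (swap-factor i e′)) , coprime-∣ʳ (n∣m*n q) i⊥e)
    , trans m≡qk′l (sym (swap-factor k′ l))
    , Coprimality.sym (coprime-* (q⊥ p∤k′) (coprime-∣ʳ (n∣m*n q) (Coprimality.sym k⊥l)))
    where
    m≡qk′l : m ≡ q ℕ.* (k′ ℕ.* l)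
    m≡qk′l = trans m≡kl (ℕ.*-assoc q k′ l)
    p∤k′ : p ∤ k′
    p∤k′ = proj₁ (cofactor-∤ {k′} {l} m≡qk′l)

-- The sum of `μ* (m / k)` over i ∥ k ∥ m

Between : ∀ i k m .{{_ : NonZero i}} .{{_ : NonZero k}} → Set
Between i k m = i ∥ k × k ∥ m

between? : ∀ i k m .{{_ : NonZero i}} .{{_ : NonZero k}} → Dec (Between i k m)
between? i k m = (i ∥? k) ×-dec (k ∥? m)

-- Extended by zero, so that `k` and `m` can range freely and their sums can be exchanged.
term : ∀ i k m .{{_ : NonZero i}} .{{_ : NonZero k}} → ℤ
term i k m = ⟦ between? i k m ⟧ * μ* (m ℕ./ k)

term-in : ∀ {i k m} .{{_ : NonZero i}} .{{_ : NonZero k}} → Between i k m → term i k m ≡ μ* (m ℕ./ k)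
term-in {i} {k} {m} v = trans (cong (_* μ* (m ℕ./ k)) (⟦⟧-true (between? i k m) v)) (ℤ.*-identityˡ _)

term-out : ∀ {i k m} .{{_ : NonZero i}} .{{_ : NonZero k}} → ¬ Between i k m → term i k m ≡ 0ℤ
term-out {i} {k} {m} ¬v = cong (_* μ* (m ℕ./ k)) (⟦⟧-false (between? i k m) ¬v)

-- Take `p` dividing N = m / i. Unitarity keeps `p` out of `i`, so the power of `p` in `N` is its
-- full power in `m`, and `m′` is `i` times the remaining part of `N`.
exact-prime-power : ∀ {i m} .{{_ : NonZero i}} .{{_ : NonZero m}} → i ∥ m → i ≢ m →
  ∃[ p ] ∃[ a ] ∃[ m′ ] Prime p × m ≡ p ℕ.^ suc a ℕ.* m′ × p ∤ m′ × p ∤ i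
exact-prime-power {i} {m} i∥m i≢m with ∥⇒∥[] i∥m
... | m≡iN , i⊥N = from-factor (prime-factor N N≢1)
  where
  N = m ℕ./ i

  instance
    N≢0 : NonZero N
    N≢0 = ℕ.≢-nonZero λ N≡0 → ℕ.≢-nonZero⁻¹ m (trans m≡iN (trans (cong (i ℕ.*_) N≡0) (ℕ.*-zeroʳ i)))

  N≢1 : N ≢ 1
  N≢1 N≡1 = i≢m (sym (trans m≡iN (trans (cong (i ℕ.*_) N≡1) (ℕ.*-identityʳ i))))

  from-factor : (∃[ p ] Prime p × p ∣ N) → ∃[ p ] ∃[ a ] ∃[ m′ ] Prime p × m ≡ p ℕ.^ suc a ℕ.* m′ × p ∤ m′ × p ∤ i
  from-factor (p , pp , p∣N) with prime-power-part pp N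
  ... | zero  , r , N≡r  , p∤r = contradiction (subst (p ∣_) (trans N≡r (ℕ.*-identityˡ r)) p∣N) p∤r
  ... | suc a , r , N≡qr , p∤r = p , a , i ℕ.* r , pp , m≡qir , [ p∤i , p∤r ]′ ∘ euclidsLemma i r pp , p∤i
    where
    q = p ℕ.^ suc a

    p∤i : p ∤ i
    p∤i p∣i = contradiction (subst Prime (i⊥N (p∣i , p∣N)) pp) ¬prime[1]

    m≡qir : m ≡ q ℕ.* (i ℕ.* r)
    m≡qir = begin
      m                  ≡⟨ m≡iN ⟩
      i ℕ.* N            ≡⟨ cong (i ℕ.*_) N≡qr ⟩
      i ℕ.* (q ℕ.* r)    ≡⟨ ℕ.*-assoc i q r ⟨
      i ℕ.* q ℕ.* r      ≡⟨ cong (ℕ._* r) (ℕ.*-comm i q) ⟩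
      q ℕ.* i ℕ.* r      ≡⟨ ℕ.*-assoc q i r ⟩
      q ℕ.* (i ℕ.* r) ∎

sum-term-∥ : ∀ {n} (i m : Fin n) → idx i ∥ idx m → i ≢ m → sum (λ (k : Fin n) → term (idx i) (idx k) (idx m)) ≡ 0ℤ
sum-term-∥ {n} i m i∥m i≢m with exact-prime-power i∥m (i≢m ∘ idx-injective)
... | p , a , m′ , pp , m≡ , p∤m′ , p∤i = sum-matching f _~_ total ~-sym ~-functional cancels
  where
  open Toggle pp a m≡ p∤m′ p∤i

  f : Fin n → ℤ
  f k = term (idx i) (idx k) (idx m)

  V : Fin n → Set
  V k = Between (idx i) (idx k) (idx m)

  V-intro : ∀ {k x e l} → idx k ≡ x → idx i ∥[ e ] x → x ∥[ l ] idx m → V k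
  V-intro refl i∥k k∥m = ∥[]⇒∥ i∥k , ∥[]⇒∥ k∥m

  -- `up` and `down` toggle the factor `q` inside `V`; `stay` fixes the indices outside `V`, where
  -- `f` vanishes. Stated as a relation, the involution gets symmetry and uniqueness by cases on
  -- constructors.
  data _~_ (k l : Fin n) : Set where
    up   : V k → p ∤ idx k → idx l ≡ q ℕ.* idx k → k ~ l
    down : V l → p ∤ idx l → idx k ≡ q ℕ.* idx l → k ~ l
    stay : ¬ V k → k ≡ l → k ~ l

  V-q* : ∀ {k l} → V k → p ∤ idx k → idx l ≡ q ℕ.* idx k → V l
  V-q* {k} (i∥k , k∥m) p∤k l≡qk with multiply (∥⇒∥[] i∥k) (∥⇒∥[] k∥m) p∤k
  ... | i∥qk , _ , _ , _ , qk∥m = V-intro l≡qk i∥qk qk∥m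

  total : ∀ k → ∃[ l ] k ~ l
  total k with between? (idx i) (idx k) (idx m) | p ∣? idx k
  ... | no ¬v             | _      = k , stay ¬v refl
  ... | yes v@(i∥k , k∥m) | no p∤k with multiply (∥⇒∥[] i∥k) (∥⇒∥[] k∥m) p∤k
  ...   | _ , l′ , _ , _ , m≡qkl′ , _ =
    go (idx-surjective (q ℕ.* idx k) m {{ℕ.m*n≢0 q (idx k)}} (subst (q ℕ.* idx k ∣_) (sym m≡qkl′) (m∣m*n l′)))
    where
    go : ∃[ l ] idx {n} l ≡ q ℕ.* idx k → ∃[ l ] k ~ l
    go (l , l≡qk) = l , up v p∤k l≡qk
  total k | yes (i∥k , k∥m) | yes p∣k with remove (∥⇒∥[] i∥k) (∥⇒∥[] k∥m) p∣k
  -- `idx k` is positive, hence so is its cofactor; the split also supplies the `NonZero` instance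
  -- for `k′`.
  ... | zero , k≡q0 , _ = contradiction (trans k≡q0 (ℕ.*-zeroʳ q)) ℕ.1+n≢0
  ... | k′@(suc _) , k≡qk′ , p∤k′ , (_ , i∥k′) , k′∥m = go (idx-surjective k′ m (proj₁ (∥[]⇒∥ k′∥m)))
    where
    go : ∃[ l ] idx {n} l ≡ k′ → ∃[ l ] k ~ l
    go (l , l≡k′) = l , down
      (V-intro l≡k′ i∥k′ k′∥m)
      (subst (p ∤_) (sym l≡k′) p∤k′)
      (trans k≡qk′ (cong (q ℕ.*_) (sym l≡k′)))

  ~-sym : ∀ {k l} → k ~ l → l ~ k
  ~-sym (up v p∤k eq)   = down v p∤k eq
  ~-sym (down v p∤l eq) = up v p∤l eq
  ~-sym (stay ¬v refl)  = stay ¬v refl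

  p∣q*⇒p∣ : ∀ {k x} → k ≡ q ℕ.* x → p ∣ k
  p∣q*⇒p∣ {x = x} k≡qx = subst (p ∣_) (sym k≡qx) (p∣q* x)

  ~-functional : ∀ {k l l′} → k ~ l → k ~ l′ → l ≡ l′
  ~-functional (up _ _ eq)    (up _ _ eq′)    = idx-injective (trans eq (sym eq′))
  -- `up` has p ∤ idx k, whereas `down` makes `idx k` a multiple of `q`.
  ~-functional (up _ p∤k _)   (down _ _ eq)   = contradiction (p∣q*⇒p∣ eq) p∤k
  ~-functional (up v _ _)     (stay ¬v _)     = contradiction v ¬v
  ~-functional (down _ _ eq)  (up _ p∤k _)    = contradiction (p∣q*⇒p∣ eq) p∤k
  ~-functional {_} {l} {l′} (down _ _ eq) (down _ _ eq′) =
    idx-injective (ℕ.*-cancelˡ-≡ (idx l) (idx l′) q (trans (sym eq) eq′))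
  -- Here `idx k` is `q` times an index in `V`, so `k` lies in `V` by `V-q*`.
  ~-functional (down v p∤l eq) (stay ¬v _)    = contradiction (V-q* v p∤l eq) ¬v
  ~-functional (stay ¬v _)    (up v _ _)      = contradiction v ¬v
  ~-functional (stay ¬v _)    (down v p∤l eq) = contradiction (V-q* v p∤l eq) ¬v
  ~-functional (stay _ refl)  (stay _ refl)   = refl

  cancels-up : ∀ {k l} → V k → p ∤ idx k → idx l ≡ q ℕ.* idx k → f k + f l ≡ 0ℤ
  cancels-up {k} {l} v@(i∥k , k∥m) p∤k l≡qk with multiply (∥⇒∥[] i∥k) (∥⇒∥[] k∥m) p∤k
  ... | _ , zero , _ , p∤0 , _ = contradiction (p ∣0) p∤0
  ... | _ , l′@(suc _) , m/k≡ql′ , p∤l′ , qk∥m = begin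
    f k + f l
      ≡⟨ cong₂ _+_ (term-in v) (term-in (V-q* v p∤k l≡qk)) ⟩
    μ* (idx m ℕ./ idx k) + μ* (idx m ℕ./ idx l)
      -- The complements of k and q k are q l′ and l′; they differ by a power of one new prime, so
      -- their signs are opposite.
      ≡⟨ cong₂ (λ x y → μ* x + μ* y) m/k≡ql′ (∥[]⇒/≡ (subst (_∥[ l′ ] idx m) (sym l≡qk) qk∥m)) ⟩
    μ* (q ℕ.* l′) + μ* l′
      ≡⟨ cong (_+ μ* l′) (μ*-prime^-* pp a l′ p∤l′) ⟩
    - μ* l′ + μ* l′
      ≡⟨ ℤ.+-inverseˡ (μ* l′) ⟩
    0ℤ ∎

  cancels : ∀ {k l} → k ~ l → f k + f l ≡ 0ℤ
  cancels (up v p∤k eq)             = cancels-up v p∤k eq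
  cancels {k} {l} (down v p∤l eq)   = trans (ℤ.+-comm (f k) (f l)) (cancels-up v p∤l eq)
  cancels (stay ¬v refl)            = cong₂ _+_ (term-out ¬v) (term-out ¬v)

-- If i ∥ m fails, transitivity makes every term vanish; if m = i, antisymmetry of divisibility
-- leaves only k = i, with `μ* 1` equal to 1; otherwise `sum-term-∥` cancels the terms.
sum-term : ∀ {n} (i m : Fin n) → sum (λ (k : Fin n) → term (idx i) (idx k) (idx m)) ≡ ⟦ m Fin.≟ i ⟧
sum-term {n} i m with m Fin.≟ i | idx i ∥? idx m
... | no m≢i | yes i∥m = sum-term-∥ i m i∥m (m≢i ∘ sym)
... | no _   | no i∦m  = sum-zero {n} λ k → term-out λ (i∥k , k∥m) → i∦m (∥-trans i∥k k∥m)
... | yes refl | _     = trans (sum-cong-≗ diagonal) (sum-δ (λ _ → 1ℤ) i)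
  where
  diagonal : ∀ k → term (idx i) (idx k) (idx i) ≡ 1ℤ * ⟦ k Fin.≟ i ⟧
  diagonal k with k Fin.≟ i
  ... | yes refl = trans (term-in (∥-refl (idx i) , ∥-refl (idx i))) (cong μ* (n/n≡1 (idx i)))
  ... | no k≢i   = term-out λ ((i∣k , _) , (k∣i , _)) → k≢i (idx-injective (∣-antisym k∣i i∣k))

-- The first column of S T

floor-/ : ∀ n d .{{_ : NonZero d}} → ∣ floor (+ n / d) ∣ ≡ n ℕ./ d
floor-/ n (suc d) = cong ∣_∣ (ℤ.*-identityˡ (+ (n ℕ./ suc d)))

-- With m = k d, the condition d ≤ n / k becomes k ∣ m ≤ n, and gcd (d , k) = 1 completes k ∣ m to k
-- ∥ m.
M*-expand : ∀ n i k .{{_ : NonZero i}} .{{_ : NonZero k}} →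
  ⟦ i ∥? k ⟧ * M*⟨ + n / k , k ⟩ ≡ ∑₁ n (λ m → term i k m)
M*-expand n i k = begin
  ⟦ i ∥? k ⟧ * M*⟨ + n / k , k ⟩
    ≡⟨ cong (λ N → ⟦ i ∥? k ⟧ * ∑₁ N summand) (floor-/ n k) ⟩
  ⟦ i ∥? k ⟧ * ∑₁ (n ℕ./ k) summand
    ≡⟨ cong (⟦ i ∥? k ⟧ *_) (∑₁-dilate k n summand) ⟩
  ⟦ i ∥? k ⟧ * ∑₁ n (λ m → ⟦ k ∣? m ⟧ * summand (m ℕ./ k))
    ≡⟨ *-distribˡ-sum ⟦ i ∥? k ⟧ (λ j → ⟦ k ∣? idx {n} j ⟧ * summand (idx {n} j ℕ./ k)) ⟩
  ∑₁ n (λ m → ⟦ i ∥? k ⟧ * (⟦ k ∣? m ⟧ * summand (m ℕ./ k)))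
    ≡⟨ sum-cong-≗ {n} (λ j → merge (idx j)) ⟩
  ∑₁ n (λ m → term i k m) ∎
  where
  summand : ℕ → ℤ
  summand d = if does (gcd d k ℕ.≟ 1) then μ* d else 0ℤ

  merge : ∀ m → ⟦ i ∥? k ⟧ * (⟦ k ∣? m ⟧ * summand (m ℕ./ k)) ≡ term i k m
  -- `M*⟨_,_⟩` and `_∥?_` take the gcd in opposite orders; once aligned, both sides depend on the
  -- same three Booleans.
  merge m rewrite gcd-comm (m ℕ./ k) k with does (i ∥? k) | does (k ∣? m) | does (gcd k (m ℕ./ k) ℕ.≟ 1)
  ... | false | _     | _     = refl
  ... | true  | false | _     = refl
  ... | true  | true  | false = refl
  ... | true  | true  | true  = ℤ.*-identityˡ _

-- Exchanging the sums over `k` and `m` makes the inner sum a Kronecker delta, which is hit exactly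
-- once because `idx i` is at most `n`.
first-column : ∀ n i → sum (λ (k : Fin n) → S n i k * M*⟨ + n / idx k , idx k ⟩) ≡ 1ℤ
first-column n i = begin
  sum (λ (k : Fin n) → S n i k * M*⟨ + n / idx k , idx k ⟩)
    ≡⟨ sum-cong-≗ {n} (λ k → M*-expand n (idx i) (idx k)) ⟩
  sum (λ (k : Fin n) → sum (λ (m : Fin n) → term (idx i) (idx k) (idx m)))
    ≡⟨ ∑-comm {n} {n} (λ k m → term (idx i) (idx k) (idx m)) ⟩
  sum (λ (m : Fin n) → sum (λ (k : Fin n) → term (idx i) (idx k) (idx m)))
    ≡⟨ sum-cong-≗ (λ m → trans (sum-term i m) (sym (ℤ.*-identityˡ _))) ⟩
  sum (λ (m : Fin n) → 1ℤ * ⟦ m Fin.≟ i ⟧)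
    ≡⟨ sum-δ (λ _ → 1ℤ) i ⟩
  1ℤ ∎

-- The factorisation and the determinant

R*-column₀ : ∀ {n} i → R* (suc n) i zero ≡ 1ℤ
R*-column₀ i = ⟦⟧-true ((idx i ∥? 1) ⊎-dec (1 ℕ.≟ 1)) (inj₂ refl)

R*-column-suc : ∀ {n} i j → R* (suc n) i (suc j) ≡ S (suc n) i (suc j)
R*-column-suc i j = ⟦⟧-⇔ (mk⇔ [ id , (λ ()) ]′ inj₁)
  ((idx i ∥? idx (suc j)) ⊎-dec (idx (suc j) ℕ.≟ 1)) (idx i ∥? idx (suc j))

R*≈S*T : ∀ n → R* n ≈ᴹ S n *ᴹ T n
R*≈S*T (suc n) i zero    = trans (R*-column₀ i) (sym (first-column (suc n) i))
R*≈S*T (suc n) i (suc j) = trans (R*-column-suc i j) (sym (sum-δ (S (suc n) i) (suc j)))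

S-unitUpper : ∀ n → UnitUpper (S n)
S-unitUpper n .diag i        = ⟦⟧-true (idx i ∥? idx i) (∥-refl (idx i))
S-unitUpper n .below i j j<i = ⟦⟧-false (idx i ∥? idx j) (λ (i∣j , _) → ℕ.<⇒≱ (s<s j<i) (∣⇒≤ i∣j))

-- `first-column` writes the column of ones as `S` times the first column of `T`. The first column
-- of `S` is a unit vector, so it contributes only `t₀`, which is M*(n) by definition.
det-R* : ∀ n → det (R* (suc n)) ≡ M* (+ suc n / 1)
det-R* n = trans (det-cong R≈A)
  (det-combination A t₀ t (unitUpper-minor₀ (S-unitUpper (suc n))) top rest)
  where
  t : Fin n → ℤ
  t k = T (suc n) (suc k) zero

  A : Matrix (suc n)
  A i zero    = 1ℤ
  A i (suc j) = S (suc n) i (suc j)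

  R≈A : R* (suc n) ≈ᴹ A
  R≈A i zero    = R*-column₀ i
  R≈A i (suc j) = R*-column-suc i j

  t₀ : ℤ
  t₀ = T (suc n) zero zero

  ∑t : Fin (suc n) → ℤ
  ∑t i = sum (λ k → S (suc n) i (suc k) * t k)

  -- Splits off the summand k = 0; unit triangularity of `S` makes `s` one in the top row and zero
  -- below.
  expand : ∀ i {s} → S (suc n) i zero ≡ s → 1ℤ ≡ s * t₀ + ∑t i
  expand i refl = sym (first-column (suc n) i)

  top : 1ℤ ≡ t₀ + ∑t zero
  top = trans (expand zero (diag (S-unitUpper (suc n)) zero)) (cong (_+ ∑t zero) (ℤ.*-identityˡ t₀))

  rest : ∀ i → 1ℤ ≡ ∑t (suc i)
  rest i = trans (expand (suc i) (below (S-unitUpper (suc n)) (suc i) zero z<s)) (ℤ.+-identityˡ (∑t (suc i)))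

M*-integer : ∀ n → M* (+ n / 1) ≡ ∑₁ n μ*
M*-integer n = begin
  M* (+ n / 1)
    ≡⟨ cong (λ N → ∑₁ N summand) (trans (floor-/ n 1) (n/1≡n n)) ⟩
  ∑₁ n summand
    ≡⟨ sum-cong-≗ {n} (λ k → cong (if_then μ* (idx k) else 0ℤ) (dec-true (gcd (idx k) 1 ℕ.≟ 1) (gcd[n,1]≡1 (idx k)))) ⟩
  ∑₁ n μ* ∎
  where
  summand : ℕ → ℤ
  summand k = if does (gcd k 1 ℕ.≟ 1) then μ* k else 0ℤ

  gcd[n,1]≡1 : ∀ k → gcd k 1 ≡ 1
  gcd[n,1]≡1 k = coprime⇒gcd≡1 (Coprimality.sym (Coprimality.1-coprimeTo k))

theorem2 : (n : ℕ) → 2 ≤ n →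
    (R* n ≈ᴹ S n *ᴹ T n) × (det (R* n) ≡ M* (+ n / 1)) × (M* (+ n / 1) ≡ ∑₁ n μ*)
theorem2 n@(suc n-1) _ = R*≈S*T n , det-R* n-1 , M*-integer n
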